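{- Let $\Gamma$ be a System F typing context, $t$ a term and $T$ a System F type such that $\Gamma\vdash t:T$ in Curry-style System F, and suppose $\dot t$ is defined. Then $\langle\Gamma\rangle\vdash t\,[T]\,\dot t$ is derivable in RelPf.
   Context: Terms are those of the pure untyped $\lambda$-calculus, up to $\alpha$-equivalence; $=_{\beta\eta}$ is $\beta\eta$-convertibility. Relational types: $R ::= X \mid R\to R' \mid \forall X.R \mid R^{\cup} \mid R\cdot R' \mid t$ (last form: promotion of a term); System F types are those built from type variables, $\to$, $\forall$ only. Curry-style System F: contexts are lists of declarations $x:T$; rules: $\Gamma\vdash x:T$ if $x:T\in\Gamma$; from $\Gamma,x:T\vdash t:T'$ infer $\Gamma\vdash\lambda x.t:T\to T'$; from $\Gamma\vdash t:T'\to T$ and $\Gamma\vdash t':T'$ infer $\Gamma\vdash t\,t':T$; from $\Gamma\vdash t:T$ with $X\notin\mathrm{FV}(\Gamma)$ infer $\Gamma\vdash t:\forall X.T$; from $\Gamma\vdash t:\forall X.T$ infer $\Gamma\vdash t:[T'/X]T$. RelPf: contexts $\Gamma ::= \cdot \mid \Gamma, t\,[R]\,t'$; judgments $\Gamma\vdash t[R]t'$ derived by: (assumption) $\Gamma\vdash t[R]t'$ if $t[R]t'\in\Gamma$; ($\to$I) from $\Gamma, x[R]x'\vdash t[R']t'$ infer $\Gamma\vdash \lambda x.t\,[R\to R']\,\lambda x'.t'$ provided $x,x'\notin\mathrm{FV}(\Gamma,R,R')$; ($\to$E) from $\Gamma\vdash t[R\to R']t'$ and $\Gamma\vdash t_1[R]t_2$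 infer $\Gamma\vdash t\,t_1[R']t'\,t_2$; ($\forall$E) from $\Gamma\vdash t[\forall X.R']t'$ infer $\Gamma\vdash t[[R/X]R']t'$; ($\forall$I) from $\Gamma\vdash t[R]t'$ with $X\notin\mathrm{FV}(\Gamma)$ infer $\Gamma\vdash t[\forall X.R]t'$; (conversion) from $\Gamma\vdash t_1[R]t_2$, $t_1=_{\beta\eta}t_1'$, $t_2=_{\beta\eta}t_2'$ infer $\Gamma\vdash t_1'[R]t_2'$; ($\cup$I) from $\Gamma\vdash t'[R]t$ infer $\Gamma\vdash t[R^\cup]t'$; ($\cup$E) from $\Gamma\vdash t[R^\cup]t'$ infer $\Gamma\vdash t'[R]t$; axiom $\Gamma\vdash t\,[t']\,t'\,t$; from $\Gamma\vdash t[t'']t'$ and $\Gamma\vdash[t'/x]t_1[R][t'/x]t_2$ infer $\Gamma\vdash[t''\,t/x]t_1[R][t''\,t/x]t_2$; from $\Gamma\vdash t[R\cdot R']t'$ and $\Gamma,t[R]x,x[R']t'\vdash t_1[R'']t_2$ with $x\notin\mathrm{FV}(\Gamma,t_1,t_2,t,t',R,R',R'')$ infer $\Gamma\vdash t_1[R'']t_2$; from $\Gamma\vdash t[R]t''$ and $\Gamma\vdash t''[R']t'$ infer $\Gamma\vdash t[R\cdot R']t'$. Fix an injection $x\mapsto\dot x$ partitioning the set of term variables. If $t$ contains no variable of the form $\dot x$ with $x\in\mathrm{FV}(t)$, then $\dot t$ (which is then said to be defined) is $t$ with every variable $x$, free or bound, renamed to $\dot x$. For a System F context, $\langle\cdot\rangle=\cdot$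 and $\langle\Gamma,x:T\rangle=\langle\Gamma\rangle, x\,[T]\,\dot x$. -}

module Defs where

open import Data.Bool using (if_then_else_)
open import Data.Fin using (Fin; inject₁; fromℕ; _↑ˡ_)
open import Data.List using (List; []; _∷_; _++_; map; concatMap)
open import Data.List.Membership.Propositional using (_∈_; _∉_)
open import Data.Nat using (ℕ; zero; suc; _+_; _≟_)
open import Data.Product using (_×_; _,_; proj₁; proj₂; ∃)
open import Function.Bundles using (_↣_; module Injection)
open import Relation.Binary.Construct.Closure.Equivalence using (EqClosure)
open import Relation.Binary.PropositionalEquality using (_≡_)
open import Relation.Nullary using (Dec; does)

------------------------------------------------------------------------
-- Pure untyped λ-terms up to α-equivalence

Var : Set
Var = ℕ

-- Locally nameless: free variables are names, bound variables are de
-- Bruijn indices.  A term of the calculus is an element of Tm 0, and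
-- _≡_ on Tm 0 is α-equivalence.  The named abstraction λx.t of the
-- paper is the function ƛ x t below.

infixl 20 _·_
infix  22 _⟦_≔_⟧

data Tm (n : ℕ) : Set where
  var : Var → Tm n
  bnd : Fin n → Tm n
  _·_ : Tm n → Tm n → Tm n
  lam : Tm (suc n) → Tm n

Term : Set
Term = Tm 0

fv : ∀ {n} → Tm n → List Var
fv (var x) = x ∷ []
fv (bnd i) = []
fv (t · u) = fv t ++ fv u
fv (lam t) = fv t

-- The new binder is the outermost one, so it has the largest index and
-- the indices already present keep their value.
close : ∀ {n} → Var → Tm n → Tm (suc n)
close {n} x (var y) = if does (x ≟ y) then bnd (fromℕ n) else var y
close x (bnd i) = bnd (inject₁ i)
close x (t · u) = close x t · close x u
close x (lam t) = lam (close x t)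

ƛ : Var → Term → Term
ƛ x t = lam (close x t)

weaken : ∀ {n} m → Tm n → Tm (n + m)
weaken m (var x) = var x
weaken m (bnd i) = bnd (i ↑ˡ m)
weaken m (t · u) = weaken m t · weaken m u
weaken m (lam t) = lam (weaken m t)

-- t ⟦ x ≔ u ⟧ is [u/x]t.
_⟦_≔_⟧ : ∀ {n} → Tm n → Var → Term → Tm n
_⟦_≔_⟧ {n} (var y) x u = if does (x ≟ y) then weaken n u else var y
bnd i    ⟦ x ≔ u ⟧ = bnd i
(t · t′) ⟦ x ≔ u ⟧ = t ⟦ x ≔ u ⟧ · t′ ⟦ x ≔ u ⟧
lam t    ⟦ x ≔ u ⟧ = lam (t ⟦ x ≔ u ⟧)

rename : ∀ {n} → (Var → Var) → Tm n → Tm n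
rename f (var x) = var (f x)
rename f (bnd i) = bnd i
rename f (t · u) = rename f t · rename f u
rename f (lam t) = lam (rename f t)

infix 4 _⟶βη_ _=βη_

data _⟶βη_ : Term → Term → Set where
  β  : ∀ x t u → ƛ x t · u ⟶βη t ⟦ x ≔ u ⟧
  η  : ∀ x t → x ∉ fv t → ƛ x (t · var x) ⟶βη t
  ξ  : ∀ x {t t′} → t ⟶βη t′ → ƛ x t ⟶βη ƛ x t′
  μˡ : ∀ {t t′ u} → t ⟶βη t′ → t · u ⟶βη t′ · u
  μʳ : ∀ {t u u′} → u ⟶βη u′ → t · u ⟶βη t · u′

_=βη_ : Term → Term → Set
_=βη_ = EqClosure _⟶βη_

------------------------------------------------------------------------
-- System F types (locally nameless, as for terms)

TVar : Set
TVar = ℕ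

infixr 15 _⇒ᶠ_ _⇒_
infix  22 _⟦_≔_⟧ᶠ _⟦_≔_⟧ᴿ

data FTy (n : ℕ) : Set where
  varᶠ : TVar → FTy n
  bndᶠ : Fin n → FTy n
  _⇒ᶠ_ : FTy n → FTy n → FTy n
  allᶠ : FTy (suc n) → FTy n

FType : Set
FType = FTy 0

ftvᶠ : ∀ {n} → FTy n → List TVar
ftvᶠ (varᶠ X) = X ∷ []
ftvᶠ (bndᶠ i) = []
ftvᶠ (S ⇒ᶠ T) = ftvᶠ S ++ ftvᶠ T
ftvᶠ (allᶠ T) = ftvᶠ T

closeᶠ : ∀ {n} → TVar → FTy n → FTy (suc n)
closeᶠ {n} X (varᶠ Y) = if does (X ≟ Y) then bndᶠ (fromℕ n) else varᶠ Y
closeᶠ X (bndᶠ i) = bndᶠ (inject₁ i)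
closeᶠ X (S ⇒ᶠ T) = closeᶠ X S ⇒ᶠ closeᶠ X T
closeᶠ X (allᶠ T) = allᶠ (closeᶠ X T)

-- The type ∀X.T.
Πᶠ : TVar → FType → FType
Πᶠ X T = allᶠ (closeᶠ X T)

weakenᶠ : ∀ {n} m → FTy n → FTy (n + m)
weakenᶠ m (varᶠ X) = varᶠ X
weakenᶠ m (bndᶠ i) = bndᶠ (i ↑ˡ m)
weakenᶠ m (S ⇒ᶠ T) = weakenᶠ m S ⇒ᶠ weakenᶠ m T
weakenᶠ m (allᶠ T) = allᶠ (weakenᶠ m T)

_⟦_≔_⟧ᶠ : ∀ {n} → FTy n → TVar → FType → FTy n
_⟦_≔_⟧ᶠ {n} (varᶠ Y) X U = if does (X ≟ Y) then weakenᶠ n U else varᶠ Y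
bndᶠ i   ⟦ X ≔ U ⟧ᶠ = bndᶠ i
(S ⇒ᶠ T) ⟦ X ≔ U ⟧ᶠ = S ⟦ X ≔ U ⟧ᶠ ⇒ᶠ T ⟦ X ≔ U ⟧ᶠ
allᶠ T   ⟦ X ≔ U ⟧ᶠ = allᶠ (T ⟦ X ≔ U ⟧ᶠ)

------------------------------------------------------------------------
-- Curry-style System F

FCtx : Set
FCtx = List (Var × FType)

dom : FCtx → List Var
dom = map proj₁

ftvᶠ-ctx : FCtx → List TVar
ftvᶠ-ctx = concatMap (λ d → ftvᶠ (proj₂ d))

infix 4 _⊢ᶠ_∶_

data _⊢ᶠ_∶_ (Γ : FCtx) : Term → FType → Set where
  ax  : ∀ {x T} → (x , T) ∈ Γ → Γ ⊢ᶠ var x ∶ T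
  -- x ∉ dom Γ is the usual convention that Γ,x:T declares a variable
  -- not yet declared in Γ; without it λx.x would have type S → T in any
  -- context containing x:T.
  →I  : ∀ {x t T T′} → x ∉ dom Γ →
        (x , T) ∷ Γ ⊢ᶠ t ∶ T′ → Γ ⊢ᶠ ƛ x t ∶ T ⇒ᶠ T′
  →E  : ∀ {t t′ T T′} →
        Γ ⊢ᶠ t ∶ T′ ⇒ᶠ T → Γ ⊢ᶠ t′ ∶ T′ → Γ ⊢ᶠ t · t′ ∶ T
  ∀I  : ∀ {X t T} → X ∉ ftvᶠ-ctx Γ → Γ ⊢ᶠ t ∶ T → Γ ⊢ᶠ t ∶ Πᶠ X T
  ∀E  : ∀ {X t T} T′ → Γ ⊢ᶠ t ∶ Πᶠ X T → Γ ⊢ᶠ t ∶ T ⟦ X ≔ T′ ⟧ᶠ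

------------------------------------------------------------------------
-- Relational types (locally nameless in the type variables; term
-- variables are never bound by a type)

infixl 16 _⨟_
infix  21 _˘

data RTy (n : ℕ) : Set where
  varᴿ : TVar → RTy n
  bndᴿ : Fin n → RTy n
  _⇒_  : RTy n → RTy n → RTy n
  allᴿ : RTy (suc n) → RTy n
  _˘   : RTy n → RTy n
  _⨟_  : RTy n → RTy n → RTy n   -- R·R′
  ⌜_⌝  : Term → RTy n            -- promotion

RType : Set
RType = RTy 0

ftvᴿ : ∀ {n} → RTy n → List TVar
ftvᴿ (varᴿ X) = X ∷ []
ftvᴿ (bndᴿ i) = []
ftvᴿ (R ⇒ S)  = ftvᴿ R ++ ftvᴿ S
ftvᴿ (allᴿ R) = ftvᴿ R
ftvᴿ (R ˘)    = ftvᴿ R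
ftvᴿ (R ⨟ S)  = ftvᴿ R ++ ftvᴿ S
ftvᴿ ⌜ t ⌝    = []

-- Free term variables.
fvᴿ : ∀ {n} → RTy n → List Var
fvᴿ (varᴿ X) = []
fvᴿ (bndᴿ i) = []
fvᴿ (R ⇒ S)  = fvᴿ R ++ fvᴿ S
fvᴿ (allᴿ R) = fvᴿ R
fvᴿ (R ˘)    = fvᴿ R
fvᴿ (R ⨟ S)  = fvᴿ R ++ fvᴿ S
fvᴿ ⌜ t ⌝    = fv t

closeᴿ : ∀ {n} → TVar → RTy n → RTy (suc n)
closeᴿ {n} X (varᴿ Y) = if does (X ≟ Y) then bndᴿ (fromℕ n) else varᴿ Y
closeᴿ X (bndᴿ i) = bndᴿ (inject₁ i)
closeᴿ X (R ⇒ S)  = closeᴿ X R ⇒ closeᴿ X S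
closeᴿ X (allᴿ R) = allᴿ (closeᴿ X R)
closeᴿ X (R ˘)    = closeᴿ X R ˘
closeᴿ X (R ⨟ S)  = closeᴿ X R ⨟ closeᴿ X S
closeᴿ X ⌜ t ⌝    = ⌜ t ⌝

-- The relational type ∀X.R.
Πᴿ : TVar → RType → RType
Πᴿ X R = allᴿ (closeᴿ X R)

weakenᴿ : ∀ {n} m → RTy n → RTy (n + m)
weakenᴿ m (varᴿ X) = varᴿ X
weakenᴿ m (bndᴿ i) = bndᴿ (i ↑ˡ m)
weakenᴿ m (R ⇒ S)  = weakenᴿ m R ⇒ weakenᴿ m S
weakenᴿ m (allᴿ R) = allᴿ (weakenᴿ m R)
weakenᴿ m (R ˘)    = weakenᴿ m R ˘
weakenᴿ m (R ⨟ S)  = weakenᴿ m R ⨟ weakenᴿ m S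
weakenᴿ m ⌜ t ⌝    = ⌜ t ⌝

_⟦_≔_⟧ᴿ : ∀ {n} → RTy n → TVar → RType → RTy n
_⟦_≔_⟧ᴿ {n} (varᴿ Y) X U = if does (X ≟ Y) then weakenᴿ n U else varᴿ Y
bndᴿ i  ⟦ X ≔ U ⟧ᴿ = bndᴿ i
(R ⇒ S) ⟦ X ≔ U ⟧ᴿ = R ⟦ X ≔ U ⟧ᴿ ⇒ S ⟦ X ≔ U ⟧ᴿ
allᴿ R  ⟦ X ≔ U ⟧ᴿ = allᴿ (R ⟦ X ≔ U ⟧ᴿ)
(R ˘)   ⟦ X ≔ U ⟧ᴿ = (R ⟦ X ≔ U ⟧ᴿ) ˘
(R ⨟ S) ⟦ X ≔ U ⟧ᴿ = R ⟦ X ≔ U ⟧ᴿ ⨟ S ⟦ X ≔ U ⟧ᴿ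
⌜ t ⌝   ⟦ X ≔ U ⟧ᴿ = ⌜ t ⌝

-- System F types as relational types.
⌊_⌋ : ∀ {n} → FTy n → RTy n
⌊ varᶠ X ⌋ = varᴿ X
⌊ bndᶠ i ⌋ = bndᴿ i
⌊ S ⇒ᶠ T ⌋ = ⌊ S ⌋ ⇒ ⌊ T ⌋
⌊ allᶠ T ⌋ = allᴿ ⌊ T ⌋

------------------------------------------------------------------------
-- RelPf

infix 6 _[_]_
infix 4 _⊢_

record Assertion : Set where
  constructor _[_]_
  field
    lhs : Term
    rel : RType
    rhs : Term

RCtx : Set
RCtx = List Assertion

ftv-ctx : RCtx → List TVar
ftv-ctx = concatMap (λ a → ftvᴿ (Assertion.rel a))

fv-assertion : Assertion → List Var
fv-assertion (t [ R ] t′) = fv t ++ fvᴿ R ++ fv t′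

fv-ctx : RCtx → List Var
fv-ctx = concatMap fv-assertion

data _⊢_ (Γ : RCtx) : Assertion → Set where
  assume : ∀ {t R t′} → t [ R ] t′ ∈ Γ → Γ ⊢ t [ R ] t′

  →I : ∀ {x x′ t t′ R R′} →
       x  ∉ fv-ctx Γ ++ fvᴿ R ++ fvᴿ R′ →
       x′ ∉ fv-ctx Γ ++ fvᴿ R ++ fvᴿ R′ →
       var x [ R ] var x′ ∷ Γ ⊢ t [ R′ ] t′ →
       Γ ⊢ ƛ x t [ R ⇒ R′ ] ƛ x′ t′
  →E : ∀ {t t′ t₁ t₂ R R′} →
       Γ ⊢ t [ R ⇒ R′ ] t′ → Γ ⊢ t₁ [ R ] t₂ →
       Γ ⊢ t · t₁ [ R′ ] t′ · t₂

  ∀I : ∀ {X t t′ R} → X ∉ ftv-ctx Γ →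
       Γ ⊢ t [ R ] t′ → Γ ⊢ t [ Πᴿ X R ] t′
  ∀E : ∀ {X t t′ R′} R →
       Γ ⊢ t [ Πᴿ X R′ ] t′ → Γ ⊢ t [ R′ ⟦ X ≔ R ⟧ᴿ ] t′

  conv : ∀ {t₁ t₂ t₁′ t₂′ R} →
         Γ ⊢ t₁ [ R ] t₂ → t₁ =βη t₁′ → t₂ =βη t₂′ →
         Γ ⊢ t₁′ [ R ] t₂′

  ˘I : ∀ {t t′ R} → Γ ⊢ t′ [ R ] t → Γ ⊢ t [ R ˘ ] t′
  ˘E : ∀ {t t′ R} → Γ ⊢ t [ R ˘ ] t′ → Γ ⊢ t′ [ R ] t

  ⌜⌝I : ∀ t t′ → Γ ⊢ t [ ⌜ t′ ⌝ ] t′ · t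
  ⌜⌝E : ∀ {t t′ t″ R} x t₁ t₂ →
        Γ ⊢ t [ ⌜ t″ ⌝ ] t′ →
        Γ ⊢ t₁ ⟦ x ≔ t′ ⟧ [ R ] t₂ ⟦ x ≔ t′ ⟧ →
        Γ ⊢ t₁ ⟦ x ≔ t″ · t ⟧ [ R ] t₂ ⟦ x ≔ t″ · t ⟧

  ⨟I : ∀ {t t′ t″ R R′} →
       Γ ⊢ t [ R ] t″ → Γ ⊢ t″ [ R′ ] t′ → Γ ⊢ t [ R ⨟ R′ ] t′
  ⨟E : ∀ {x t t′ t₁ t₂ R R′ R″} →
       x ∉ fv-ctx Γ ++ fv t₁ ++ fv t₂ ++ fv t ++ fv t′
             ++ fvᴿ R ++ fvᴿ R′ ++ fvᴿ R″ →
       Γ ⊢ t [ R ⨟ R′ ] t′ →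
       var x [ R′ ] t′ ∷ t [ R ] var x ∷ Γ ⊢ t₁ [ R″ ] t₂ →
       Γ ⊢ t₁ [ R″ ] t₂

------------------------------------------------------------------------
-- The map x ↦ ẋ

-- The injection partitions the variables into those of the form ẋ and
-- the others: each variable falls in exactly one of the two classes.
Partitions : Var ↣ Var → Set
Partitions δ = ∀ y → Dec (∃ λ x → y ≡ Injection.to δ x)

-- ṫ is defined: ẋ does not occur in t for any x ∈ FV(t).  Bound names
-- can be chosen freely in an α-class, so only free occurrences matter.
DotDefined : Var ↣ Var → Term → Set
DotDefined δ t = ∀ {x} → x ∈ fv t → Injection.to δ x ∉ fv t

-- ṫ.  Renaming a bound variable does not change the α-class.
dot : Var ↣ Var → Term → Term
dot δ = rename (Injection.to δ)

⟨_⟩ : FCtx → Var ↣ Var → RCtx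
⟨ [] ⟩ δ = []
⟨ (x , T) ∷ Γ ⟩ δ = var x [ ⌊ T ⌋ ] var (Injection.to δ x) ∷ ⟨ Γ ⟩ δ

{-# OPTIONS --safe #-}
-- For renamings ρ and σ of the term variables, every typing Γ ⊢ t : T
-- gives Δ ⊢ ρ(t) [T] σ(t) as soon as Δ contains ρ(x) [S] σ(x) for each
-- x : S in Γ.  Quantifying over ρ and σ lets each abstraction move its
-- bound variable to a name fresh for Δ on either side, so the induction
-- on typings needs no separate lemma on renaming in a typing.  The
-- theorem is the case where ρ is the identity and σ is x ↦ ẋ.
module Submission where

open import Defs
open import Data.Bool using (true; false; if_then_else_)
open import Data.Empty using (⊥-elim)
open import Data.List using ([]; _∷_; _++_)
open import Data.List.Extrema.Nat using (max; xs≤max)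
open import Data.List.Membership.Propositional using (_∈_; _∉_; lose)
open import Data.List.Membership.Propositional.Properties
  using (∈-++⁺ˡ; ∈-++⁺ʳ; ∈-++⁻; ∈-map⁺; ∈-map⁻; ∈-concatMap⁺)
open import Data.List.Relation.Binary.Subset.Propositional using (_⊆_)
open import Data.List.Relation.Binary.Subset.Propositional.Properties
  using (++⁺ʳ)
import Data.List.Relation.Unary.All as All
open import Data.List.Relation.Unary.Any using (here; there)
open import Data.Nat using (suc; _≟_)
open import Data.Nat.Properties using (1+n≰n)
open import Data.Product using (_×_; _,_; proj₁; proj₂; ∃)
open import Data.Sum using (inj₁; inj₂)
open import Function using (_∘_; id)
open import Function.Bundles using (_↣_; module Injection)
open import Relation.Binary.PropositionalEquality
  using (_≡_; _≢_; refl; sym; cong; cong₂; subst; subst₂)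
open import Relation.Nullary using (does; yes; no)
open import Relation.Nullary.Decidable using (dec-true; dec-false)

fresh : ∀ xs → ∃ λ x → x ∉ xs
fresh xs = suc (max 0 xs) , 1+n≰n ∘ All.lookup (xs≤max 0 xs)

infix 30 _[_↦_]

_[_↦_] : (Var → Var) → Var → Var → Var → Var
(ρ [ x ↦ z ]) y = if does (x ≟ y) then z else ρ y

rename-id : ∀ {n} (t : Tm n) → rename id t ≡ t
rename-id (var x) = refl
rename-id (bnd i) = refl
rename-id (t · u) = cong₂ _·_ (rename-id t) (rename-id u)
rename-id (lam t) = cong lam (rename-id t)

-- Closing over `z` captures the images of `x` and, by the hypothesis, no image of another free
-- variable. Hence a bound `x` may become `z` while the free variables follow `ρ`.
rename-close : ∀ {n} ρ x z (t : Tm n) →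
  (∀ {y} → y ∈ fv t → x ≢ y → z ≢ ρ y) →
  rename ρ (close x t) ≡ close z (rename (ρ [ x ↦ z ]) t)
rename-close ρ x z (var y) z∉ with x ≟ y
... | yes refl
  rewrite dec-true (x ≟ x) refl | dec-true (z ≟ z) refl = refl
... | no x≢y
  rewrite dec-false (x ≟ y) x≢y
        | dec-false (z ≟ ρ y) (z∉ (here refl) x≢y) = refl
rename-close ρ x z (bnd i) z∉ = refl
rename-close ρ x z (t · u) z∉ =
  cong₂ _·_ (rename-close ρ x z t (z∉ ∘ ∈-++⁺ˡ))
            (rename-close ρ x z u (z∉ ∘ ∈-++⁺ʳ (fv t)))
rename-close ρ x z (lam t) z∉ = cong lam (rename-close ρ x z t z∉)

fv-close : ∀ {n} x (t : Tm n) {y} → y ∈ fv (close x t) → y ∈ fv t × x ≢ y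
fv-close x (var z) p with x ≟ z
fv-close x (var z) p | yes x≡z rewrite dec-true (x ≟ z) x≡z with () ← p
fv-close x (var z) p | no x≢z rewrite dec-false (x ≟ z) x≢z
  with here refl ← p = here refl , x≢z
fv-close x (t · u) p with ∈-++⁻ (fv (close x t)) p
... | inj₁ q with y∈t , x≢y ← fv-close x t q = ∈-++⁺ˡ y∈t , x≢y
... | inj₂ q with y∈u , x≢y ← fv-close x u q = ∈-++⁺ʳ (fv t) y∈u , x≢y
fv-close x (lam t) p = fv-close x t p

∉∈⇒≢ : ∀ {z y : Var} {xs} → z ∉ xs → y ∈ xs → z ≢ y
∉∈⇒≢ z∉ y∈ refl = z∉ y∈

∈-tail : ∀ {x y : Var} {xs} → x ≢ y → y ∈ x ∷ xs → y ∈ xs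
∈-tail x≢y (here refl) = ⊥-elim (x≢y refl)
∈-tail x≢y (there p)   = p

-- Lets `Realises`, which speaks of declared variables only, apply to every free variable of a typed
-- term.
fv⊆dom : ∀ {Γ t T} → Γ ⊢ᶠ t ∶ T → fv t ⊆ dom Γ
fv⊆dom (ax x∈Γ) (here refl) = ∈-map⁺ proj₁ x∈Γ
fv⊆dom (→I {x} {t} _ d) p with y∈t , x≢y ← fv-close x t p =
  ∈-tail x≢y (fv⊆dom d y∈t)
fv⊆dom (→E {t} d e) p with ∈-++⁻ (fv t) p
... | inj₁ q = fv⊆dom d q
... | inj₂ q = fv⊆dom e q
fv⊆dom (∀I _ d) p = fv⊆dom d p
fv⊆dom (∀E _ d) p = fv⊆dom d p

-- At the top level this identifies `⌊ Πᶠ X T ⌋` with `Πᴿ X ⌊ T ⌋`, as both quantifier rules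
-- require.
⌊⌋-close : ∀ {n} X (T : FTy n) → ⌊ closeᶠ X T ⌋ ≡ closeᴿ X ⌊ T ⌋
⌊⌋-close X (varᶠ Y) with does (X ≟ Y)
... | true  = refl
... | false = refl
⌊⌋-close X (bndᶠ i) = refl
⌊⌋-close X (S ⇒ᶠ T) = cong₂ _⇒_ (⌊⌋-close X S) (⌊⌋-close X T)
⌊⌋-close X (allᶠ T) = cong allᴿ (⌊⌋-close X T)

⌊⌋-weaken : ∀ {n} m (T : FTy n) → ⌊ weakenᶠ m T ⌋ ≡ weakenᴿ m ⌊ T ⌋
⌊⌋-weaken m (varᶠ X) = refl
⌊⌋-weaken m (bndᶠ i) = refl
⌊⌋-weaken m (S ⇒ᶠ T) = cong₂ _⇒_ (⌊⌋-weaken m S) (⌊⌋-weaken m T)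
⌊⌋-weaken m (allᶠ T) = cong allᴿ (⌊⌋-weaken m T)

⌊⌋-subst : ∀ {n} (T : FTy n) X U → ⌊ T ⟦ X ≔ U ⟧ᶠ ⌋ ≡ ⌊ T ⌋ ⟦ X ≔ ⌊ U ⌋ ⟧ᴿ
⌊⌋-subst {n} (varᶠ Y) X U with does (X ≟ Y)
... | true  = ⌊⌋-weaken n U
... | false = refl
⌊⌋-subst (bndᶠ i) X U = refl
⌊⌋-subst (S ⇒ᶠ T) X U = cong₂ _⇒_ (⌊⌋-subst S X U) (⌊⌋-subst T X U)
⌊⌋-subst (allᶠ T) X U = cong allᴿ (⌊⌋-subst T X U)

ftv-⌊⌋ : ∀ {n} (T : FTy n) → ftvᴿ ⌊ T ⌋ ≡ ftvᶠ T
ftv-⌊⌋ (varᶠ X) = refl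
ftv-⌊⌋ (bndᶠ i) = refl
ftv-⌊⌋ (S ⇒ᶠ T) = cong₂ _++_ (ftv-⌊⌋ S) (ftv-⌊⌋ T)
ftv-⌊⌋ (allᶠ T) = ftv-⌊⌋ T

fv-lhs : ∀ {Δ x R t} → var x [ R ] t ∈ Δ → x ∈ fv-ctx Δ
fv-lhs p = ∈-concatMap⁺ fv-assertion (lose p (here refl))

fv-rhs : ∀ {Δ t R x} → t [ R ] var x ∈ Δ → x ∈ fv-ctx Δ
fv-rhs {t = t} {R} p = ∈-concatMap⁺ fv-assertion
  (lose p (∈-++⁺ʳ (fv t) (∈-++⁺ʳ (fvᴿ R) (here refl))))

-- `lookup` settles the variable rule; `ftv⊆` carries the side condition of `∀I` from `Γ` over to
-- `Δ`.
record Realises (ρ σ : Var → Var) (Γ : FCtx) (Δ : RCtx) : Set where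
  field
    lookup : ∀ {x T} → (x , T) ∈ Γ → var (ρ x) [ ⌊ T ⌋ ] var (σ x) ∈ Δ
    ftv⊆   : ftv-ctx Δ ⊆ ftvᶠ-ctx Γ

  declared : ∀ {x} → x ∈ dom Γ → ∃ λ T → var (ρ x) [ ⌊ T ⌋ ] var (σ x) ∈ Δ
  declared p with (_ , T) , q , refl ← ∈-map⁻ proj₁ p = T , lookup q

  lhs∈ : ∀ {x} → x ∈ dom Γ → ρ x ∈ fv-ctx Δ
  lhs∈ = fv-lhs ∘ proj₂ ∘ declared

  rhs∈ : ∀ {x} → x ∈ dom Γ → σ x ∈ fv-ctx Δ
  rhs∈ p with T , q ← declared p = fv-rhs {R = ⌊ T ⌋} q

open Realises

-- Since `x` is not declared in `Γ`, updating at `x` leaves the images of all earlier declarations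
-- unchanged. Nothing is asked of `z` yet.
extend : ∀ {ρ σ Γ Δ x T} z → x ∉ dom Γ → Realises ρ σ Γ Δ →
  Realises (ρ [ x ↦ z ]) (σ [ x ↦ z ]) ((x , T) ∷ Γ)
           (var z [ ⌊ T ⌋ ] var z ∷ Δ)
extend {x = x} z x∉Γ r .lookup (here refl)
  rewrite dec-true (x ≟ x) refl = here refl
extend {x = x} z x∉Γ r .lookup {y} (there p)
  rewrite dec-false (x ≟ y) (λ { refl → x∉Γ (∈-map⁺ proj₁ p) }) =
  there (lookup r p)
extend {T = T} z x∉Γ r .ftv⊆ rewrite ftv-⌊⌋ T = ++⁺ʳ (ftvᶠ T) (ftv⊆ r)

sound : ∀ {ρ σ Γ Δ t T} → Realises ρ σ Γ Δ → Γ ⊢ᶠ t ∶ T →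
  Δ ⊢ rename ρ t [ ⌊ T ⌋ ] rename σ t
sound r (ax p) = assume (lookup r p)
sound {ρ} {σ} {Δ = Δ} r (→I {x} {t} {T} {T′} x∉Γ d) =
  subst₂ (λ u v → Δ ⊢ u [ ⌊ T ⇒ᶠ T′ ⌋ ] v)
    -- A free `y` of the body other than `x` is declared in `Γ`, so `ρ y` occurs in `Δ` and cannot
    -- be `z`. The same argument then serves `σ`.
    (sym (cong lam (rename-close ρ x z t λ y∈t x≢y →
      ∉∈⇒≢ z∉Δ (lhs∈ r (∈-tail x≢y (fv⊆dom d y∈t))))))
    (sym (cong lam (rename-close σ x z t λ y∈t x≢y →
      ∉∈⇒≢ z∉Δ (rhs∈ r (∈-tail x≢y (fv⊆dom d y∈t))))))
    (→I z∉ z∉ (sound (extend z x∉Γ r) d))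
  where
  -- The list is that of the side conditions of the relational `→I`; one name serves as binder on
  -- both sides.
  z   = proj₁ (fresh (fv-ctx Δ ++ fvᴿ ⌊ T ⌋ ++ fvᴿ ⌊ T′ ⌋))
  z∉  = proj₂ (fresh (fv-ctx Δ ++ fvᴿ ⌊ T ⌋ ++ fvᴿ ⌊ T′ ⌋))
  z∉Δ : z ∉ fv-ctx Δ
  z∉Δ = z∉ ∘ ∈-++⁺ˡ
sound r (→E d e) = →E (sound r d) (sound r e)
sound r (∀I {X} {T = T} X∉ d) rewrite ⌊⌋-close X T =
  ∀I (X∉ ∘ ftv⊆ r) (sound r d)
sound r (∀E {X} {T = T} T′ d) with sound r d
-- The first equation puts the induction hypothesis in the form of the premise of the relational
-- `∀E`, the second puts the goal in the form of its conclusion.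
... | e rewrite ⌊⌋-close X T | ⌊⌋-subst T X T′ =
  ∀E {X = X} {R′ = ⌊ T ⌋} ⌊ T′ ⌋ e

realises-⟨⟩ : ∀ δ Γ → Realises id (Injection.to δ) Γ (⟨ Γ ⟩ δ)
realises-⟨⟩ δ (_ ∷ Γ) .lookup (here refl) = here refl
realises-⟨⟩ δ (_ ∷ Γ) .lookup (there p)   = there (lookup (realises-⟨⟩ δ Γ) p)
realises-⟨⟩ δ ((_ , T) ∷ Γ) .ftv⊆ rewrite ftv-⌊⌋ T =
  ++⁺ʳ (ftvᶠ T) (ftv⊆ (realises-⟨⟩ δ Γ))
realises-⟨⟩ δ [] .ftv⊆ ()

mainTheorem6 : (δ : Var ↣ Var) → Partitions δ →
    (Γ : FCtx) (t : Term) (T : FType) →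
    Γ ⊢ᶠ t ∶ T → DotDefined δ t →
    ⟨ Γ ⟩ δ ⊢ t [ ⌊ T ⌋ ] dot δ t
mainTheorem6 δ _ Γ t T d _ =
  -- The left term arrives as `rename id t`; the right one is `dot δ t` by definition.
  subst (λ u → ⟨ Γ ⟩ δ ⊢ u [ ⌊ T ⌋ ] dot δ t) (rename-id t)
    (sound (realises-⟨⟩ δ Γ) d)
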